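{- For all positive integers $n,m$, \[s\text{ - }sat(Q_n,Q_m)<\Big(m^2+\frac{m}{2}\Big)2^n.\]
   Context: $Q_n$ is the hypercube on $\{0,1\}^n$ with edges between vertices differing in exactly one coordinate. A copy of $F$ is a subgraph isomorphic to $F$. A graph $G$ is $(Q_n,F)$-semi-saturated if $G$ is a subgraph of $Q_n$ and adding any edge of $E(Q_n)\setminus E(G)$ increases the number of copies of $F$. $s\text{ - }sat(Q_n,F)$ is the minimum number of edges of a $(Q_n,F)$-semi-saturated graph. -}

module Defs where

open import Data.Bool.Base using (Bool; true; false)
open import Data.Fin.Base using (Fin; finToFun; funToFin)
open import Data.Fin.Properties using (_≟_; _<?_; all?; any?; finToFun-funToFin)
open import Data.Fin.Subset using (Subset; _∈_; _∪_; ⁅_⁆; ⊤)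
open import Data.Fin.Subset.Properties using (_∈?_; ∈⊤)
open import Data.Integer.Base using (+_)
open import Data.List.Base
  using (List; []; _∷_; length; map; filter; allFin; cartesianProduct; cartesianProductWith)
open import Data.List.Extrema.Nat using (min; argmin-sel; min≤xs)
open import Data.List.Membership.Propositional renaming (_∈_ to _∈ˡ_) using ()
open import Data.List.Membership.Propositional.Properties
  using (∈-cartesianProductWith⁺; ∈-filter⁺; ∈-filter⁻; ∈-map⁺; ∈-map⁻)
import Data.List.Relation.Unary.All as All
open import Data.List.Relation.Unary.AllPairs using ([]; _∷_)
open import Data.List.Relation.Unary.Any using (here; there)
open import Data.List.Relation.Unary.Unique.Propositional using (Unique)
import Data.List.Relation.Unary.Unique.Propositional.Properties as Unique
open import Data.Nat.Base using (ℕ; zero; suc; _^_; _≤_) renaming (_<_ to _<ⁿ_)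
import Data.Nat.Properties as ℕ
open import Data.Product.Base using (∃-syntax; _×_; _,_; proj₂)
open import Data.Product using (∃!)
open import Data.Rational.Base using (ℚ; _/_)
open import Data.Sum.Base using ([_,_]′)
open import Data.Vec.Base using (Vec; []; _∷_; lookup; tabulate; updateAt)
open import Data.Vec.Properties using (lookup∘tabulate; ∷-injective; []=⇒lookup; lookup⇒[]=)
open import Function.Base using (_∘_)
open import Function.Bundles using (_⇔_; mk⇔; Equivalence)
open import Level using (0ℓ)
open import Relation.Binary.Core using (Rel)
open import Relation.Binary.Definitions using (Decidable; Symmetric; Irreflexive)
open import Relation.Binary.PropositionalEquality
  using (_≡_; _≢_; _≗_; refl; sym; trans; cong; subst₂)
open import Relation.Nullary.Decidable
  using (Dec; yes; no; does; map′; ¬?; _×-dec_; _→-dec_)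
open import Relation.Nullary.Negation using (¬_; contradiction)

-- Finite simple graphs with vertex set Fin N.

record Graph (N : ℕ) : Set₁ where
  field
    Adj    : Rel (Fin N) 0ℓ
    adj?   : Decidable Adj
    symm   : Symmetric Adj
    irrefl : Irreflexive _≡_ Adj

open Graph public

-- A vertex of Q n is an element of Fin (2 ^ n), read as an element of {0,1}ⁿ
-- through the bijection finToFun.

coordinate : ∀ n → Fin (2 ^ n) → Fin n → Fin 2
coordinate n = finToFun {2} {n}

DifferInOne : ∀ n → Rel (Fin (2 ^ n)) 0ℓ
DifferInOne n u v = ∃! _≡_ λ i → coordinate n u i ≢ coordinate n v i

differInOne? : ∀ n → Decidable (DifferInOne n)
differInOne? n u v = any? λ i →
  differ? i ×-dec map′ (λ f {j} → f j) (λ f j → f {j}) (all? λ j → differ? j →-dec i ≟ j)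
  where differ? = λ i → ¬? (coordinate n u i ≟ coordinate n v i)

Q : ∀ n → Graph (2 ^ n)
Q n = record
  { Adj    = DifferInOne n
  ; adj?   = differInOne? n
  ; symm   = λ (i , ≢ , unique) → i , ≢ ∘ sym , λ ≢′ → unique (≢′ ∘ sym)
  ; irrefl = λ { refl (i , ≢ , _) → ≢ refl }
  }

-- Candidate subgraphs of a graph on Fin N: a vertex set together with an
-- adjacency matrix, row u being the set of neighbours of u.  This is first-order
-- data, so that distinct subgraphs are exactly propositionally distinct elements
-- and can be counted; that the data form a simple graph is IsSimple below.

record Subgraph (N : ℕ) : Set where
  constructor ⟨_,_⟩
  field
    vertices   : Subset N
    neighbours : Vec (Subset N) N

  Edge : Rel (Fin N) 0ℓ
  Edge u v = v ∈ lookup neighbours u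

open Subgraph public

edge? : ∀ {N} (H : Subgraph N) → Decidable (Edge H)
edge? H u v = v ∈? lookup (neighbours H) u

record IsSimple {N} (H : Subgraph N) : Set where
  field
    edge-sym      : ∀ u v → Edge H u v → Edge H v u
    edge-irrefl   : ∀ u → ¬ Edge H u u
    edge-incident : ∀ u v → Edge H u v → u ∈ vertices H

open IsSimple public

record _IsSubgraphOf_ {N} (H : Subgraph N) (G : Graph N) : Set where
  field
    simple   : IsSimple H
    edge⇒adj : ∀ u v → Edge H u v → Adj G u v

open _IsSubgraphOf_ public

infix 4 _⊑_

record _⊑_ {N} (H G : Subgraph N) : Set where
  field
    vertices-⊆ : ∀ u → u ∈ vertices H → u ∈ vertices G
    edges-⊆    : ∀ u v → Edge H u v → Edge G u v

open _⊑_ public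

record IsIso {k N} (F : Graph k) (H : Subgraph N) (f : Fin k → Fin N) : Set where
  field
    injective : ∀ x y → f x ≡ f y → x ≡ y
    image     : ∀ v → v ∈ vertices H ⇔ (∃[ x ] f x ≡ v)
    edges     : ∀ x y → Adj F x y ⇔ Edge H (f x) (f y)

open IsIso public

infix 4 _≅_

_≅_ : ∀ {k N} → Graph k → Subgraph N → Set
F ≅ H = ∃[ f ] IsIso F H f

record IsCopyIn {k N} (F : Graph k) (G : Subgraph N) (H : Subgraph N) : Set where
  field
    simple : IsSimple H
    ⊑G     : H ⊑ G
    iso    : F ≅ H

private
  _⇔-dec_ : ∀ {A B : Set} → Dec A → Dec B → Dec (A ⇔ B)
  a? ⇔-dec b? = map′ (λ (f , g) → mk⇔ f g) (λ e → Equivalence.to e , Equivalence.from e)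
                     ((a? →-dec b?) ×-dec (b? →-dec a?))

isSimple? : ∀ {N} (H : Subgraph N) → Dec (IsSimple H)
isSimple? H = map′
  (λ (s , i , e) → record { edge-sym = s ; edge-irrefl = i ; edge-incident = e })
  (λ p → edge-sym p , edge-irrefl p , edge-incident p)
  (     (all? λ u → all? λ v → edge? H u v →-dec edge? H v u)
  ×-dec (all? λ u → ¬? (edge? H u u))
  ×-dec (all? λ u → all? λ v → edge? H u v →-dec u ∈? vertices H))

isSubgraphOf? : ∀ {N} (H : Subgraph N) (G : Graph N) → Dec (H IsSubgraphOf G)
isSubgraphOf? H G = map′
  (λ (s , e) → record { simple = s ; edge⇒adj = e })
  (λ p → simple p , edge⇒adj p)
  (isSimple? H ×-dec (all? λ u → all? λ v → edge? H u v →-dec adj? G u v))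

_⊑?_ : ∀ {N} → Decidable (_⊑_ {N})
H ⊑? G = map′
  (λ (v , e) → record { vertices-⊆ = v ; edges-⊆ = e })
  (λ p → vertices-⊆ p , edges-⊆ p)
  (     (all? λ u → u ∈? vertices H →-dec u ∈? vertices G)
  ×-dec (all? λ u → all? λ v → edge? H u v →-dec edge? G u v))

isIso? : ∀ {k N} (F : Graph k) (H : Subgraph N) f → Dec (IsIso F H f)
isIso? F H f = map′
  (λ (i , s , e) → record { injective = i ; image = s ; edges = e })
  (λ p → injective p , image p , edges p)
  (     (all? λ x → all? λ y → f x ≟ f y →-dec x ≟ y)
  ×-dec (all? λ v → (v ∈? vertices H) ⇔-dec (any? λ x → f x ≟ v))
  ×-dec (all? λ x → all? λ y → adj? F x y ⇔-dec edge? H (f x) (f y)))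

isIso-resp-≗ : ∀ {k N} {F : Graph k} {H : Subgraph N} {f g} → f ≗ g → IsIso F H f → IsIso F H g
isIso-resp-≗ {H = H} {f} {g} f≗g p = record
  { injective = λ x y gx≡gy → injective p x y (trans (f≗g x) (trans gx≡gy (sym (f≗g y))))
  ; image     = λ v → mk⇔
      (λ v∈ → let (x , fx≡v) = Equivalence.to (image p v) v∈ in x , trans (sym (f≗g x)) fx≡v)
      (λ (x , gx≡v) → Equivalence.from (image p v) (x , trans (f≗g x) gx≡v))
  ; edges     = λ x y → subst₂ (λ a b → _ ⇔ Edge H a b) (f≗g x) (f≗g y) (edges p x y)
  }

-- The search for an isomorphism ranges over Fin (N ^ k), which enumerates the
-- functions Fin k → Fin N up to pointwise equality.

_≅?_ : ∀ {k N} (F : Graph k) (H : Subgraph N) → Dec (F ≅ H)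
_≅?_ {k} {N} F H = map′
  (λ (c , p) → finToFun {N} {k} c , p)
  (λ (f , p) → funToFin f , isIso-resp-≗ (λ x → sym (finToFun-funToFin f x)) p)
  (any? λ (c : Fin (N ^ k)) → isIso? F H (finToFun {N} {k} c))

isCopyIn? : ∀ {k N} (F : Graph k) (G H : Subgraph N) → Dec (IsCopyIn F G H)
isCopyIn? F G H = map′
  (λ (s , l , i) → record { simple = s ; ⊑G = l ; iso = i })
  (λ p → IsCopyIn.simple p , IsCopyIn.⊑G p , IsCopyIn.iso p)
  (isSimple? H ×-dec H ⊑? G ×-dec F ≅? H)

allVecs : ∀ {A : Set} → List A → ∀ n → List (Vec A n)
allVecs xs zero    = [] ∷ []
allVecs xs (suc n) = cartesianProductWith _∷_ xs (allVecs xs n)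

allSubsets : ∀ N → List (Subset N)
allSubsets = allVecs (true ∷ false ∷ [])

allSubgraphs : ∀ N → List (Subgraph N)
allSubgraphs N = cartesianProductWith ⟨_,_⟩ (allSubsets N) (allVecs (allSubsets N) N)

#copies : ∀ {k N} → Graph k → Subgraph N → ℕ
#copies {N = N} F G = length (filter (isCopyIn? F G) (allSubgraphs N))

-- Each edge uv is counted once, as the ordered pair with u < v.

#edges : ∀ {N} → Subgraph N → ℕ
#edges {N} G = length (filter (λ (u , v) → u <? v ×-dec edge? G u v)
                              (cartesianProduct (allFin N) (allFin N)))

addEdge : ∀ {N} → Fin N → Fin N → Subgraph N → Subgraph N
addEdge u v G = ⟨ vertices G ∪ (⁅ u ⁆ ∪ ⁅ v ⁆)
                , updateAt (updateAt (neighbours G) u (_∪ ⁅ v ⁆)) v (_∪ ⁅ u ⁆) ⟩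

record SemiSaturated {k N} (K : Graph N) (F : Graph k) (G : Subgraph N) : Set where
  field
    subgraph : G IsSubgraphOf K
    increase : ∀ u v → Adj K u v → ¬ Edge G u v → #copies F G <ⁿ #copies F (addEdge u v G)

open SemiSaturated public

semiSaturated? : ∀ {k N} (K : Graph N) (F : Graph k) G → Dec (SemiSaturated K F G)
semiSaturated? K F G = map′
  (λ (s , i) → record { subgraph = s ; increase = i })
  (λ p → subgraph p , increase p)
  (isSubgraphOf? G K ×-dec (all? λ u → all? λ v →
    adj? K u v →-dec (¬? (edge? G u v) →-dec (#copies F G ℕ.<? #copies F (addEdge u v G)))))

whole : ∀ {N} → Graph N → Subgraph N
whole K = ⟨ ⊤ , tabulate (λ u → tabulate (λ v → does (adj? K u v))) ⟩

-- min takes a default value for the empty list; here it is the number of edges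
-- of K, which is itself (K,F)-semi-saturated.  See s-sat-attained, s-sat-minimal.

semiSaturatedSizes : ∀ {k N} → Graph N → Graph k → List ℕ
semiSaturatedSizes {N = N} K F = map #edges (filter (semiSaturated? K F) (allSubgraphs N))

s-sat : ∀ {k N} → Graph N → Graph k → ℕ
s-sat K F = min (#edges (whole K)) (semiSaturatedSizes K F)

ℕ→ℚ : ℕ → ℚ
ℕ→ℚ k = + k / 1

allVecs-complete : ∀ {A : Set} {xs : List A} → (∀ x → x ∈ˡ xs) →
                   ∀ {n} (v : Vec A n) → v ∈ˡ allVecs xs n
allVecs-complete ∈xs []      = here refl
allVecs-complete ∈xs (x ∷ v) = ∈-cartesianProductWith⁺ _∷_ (∈xs x) (allVecs-complete ∈xs v)

allVecs-unique : ∀ {A : Set} {xs : List A} → Unique xs → ∀ n → Unique (allVecs xs n)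
allVecs-unique xs! zero    = All.[] ∷ []
allVecs-unique xs! (suc n) =
  Unique.cartesianProductWith⁺ _∷_ ∷-injective xs! (allVecs-unique xs! n)

allSubsets-complete : ∀ {N} (p : Subset N) → p ∈ˡ allSubsets N
allSubsets-complete = allVecs-complete λ { true → here refl ; false → there (here refl) }

allSubsets-unique : ∀ N → Unique (allSubsets N)
allSubsets-unique = allVecs-unique (((λ ()) All.∷ All.[]) ∷ (All.[] ∷ []))

allSubgraphs-complete : ∀ {N} (H : Subgraph N) → H ∈ˡ allSubgraphs N
allSubgraphs-complete ⟨ V , E ⟩ = ∈-cartesianProductWith⁺ ⟨_,_⟩
  (allSubsets-complete V) (allVecs-complete allSubsets-complete E)

allSubgraphs-unique : ∀ N → Unique (allSubgraphs N)
allSubgraphs-unique N = Unique.cartesianProductWith⁺ ⟨_,_⟩ (λ { refl → refl , refl })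
  (allSubsets-unique N) (allVecs-unique (allSubsets-unique N) N)

whole-edge : ∀ {N} (K : Graph N) u v → Edge (whole K) u v ⇔ Adj K u v
whole-edge K u v = mk⇔
  (λ e → to (trans (sym eq) ([]=⇒lookup e)))
  (λ a → lookup⇒[]= v _ (trans eq (from a)))
  where
  eq : lookup (lookup (neighbours (whole K)) u) v ≡ does (adj? K u v)
  eq = trans (cong (λ r → lookup r v) (lookup∘tabulate _ u)) (lookup∘tabulate _ v)

  to : does (adj? K u v) ≡ true → Adj K u v
  to with adj? K u v
  ... | yes a = λ _ → a
  ... | no _  = λ ()

  from : Adj K u v → does (adj? K u v) ≡ true
  from a with adj? K u v
  ... | yes _ = refl
  ... | no ¬a = contradiction a ¬a

whole-semiSaturated : ∀ {k N} (K : Graph N) (F : Graph k) → SemiSaturated K F (whole K)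
whole-semiSaturated K F = record
  { subgraph = record
    { simple = record
      { edge-sym      = λ u v e → from v u (symm K (to u v e))
      ; edge-irrefl   = λ u e → irrefl K refl (to u u e)
      ; edge-incident = λ _ _ _ → ∈⊤
      }
    ; edge⇒adj = to
    }
  ; increase = λ u v a ¬e → contradiction (from u v a) ¬e
  }
  where
  to   = λ u v → Equivalence.to   (whole-edge K u v)
  from = λ u v → Equivalence.from (whole-edge K u v)

s-sat-attained : ∀ {k N} (K : Graph N) (F : Graph k) →
                 ∃[ G ] SemiSaturated K F G × #edges G ≡ s-sat K F
s-sat-attained {N = N} K F =
  [ (λ eq → whole K , whole-semiSaturated K F , sym eq) , fromSizes ]′
    (argmin-sel (λ x → x) (#edges (whole K)) (semiSaturatedSizes K F))
  where
  fromSizes : s-sat K F ∈ˡ semiSaturatedSizes K F →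
              ∃[ G ] SemiSaturated K F G × #edges G ≡ s-sat K F
  fromSizes ∈sizes =
    let (G , G∈ , eq) = ∈-map⁻ #edges {xs = filter (semiSaturated? K F) (allSubgraphs N)} ∈sizes
    in G , proj₂ (∈-filter⁻ (semiSaturated? K F) {xs = allSubgraphs N} G∈) , sym eq

s-sat-minimal : ∀ {k N} (K : Graph N) (F : Graph k) {G} →
                SemiSaturated K F G → s-sat K F ≤ #edges G
s-sat-minimal {N = N} K F {G} p =
  All.lookup (min≤xs (#edges (whole K)) (semiSaturatedSizes K F)) size∈
  where
  size∈ : #edges G ∈ˡ semiSaturatedSizes K F
  size∈ = ∈-map⁺ #edges {xs = filter (semiSaturated? K F) (allSubgraphs N)}
    (∈-filter⁺ (semiSaturated? K F) {xs = allSubgraphs N} (allSubgraphs-complete G) p)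

{-# OPTIONS --safe #-}
module Submission where

-- If n < m, then Q n itself has few enough edges.  Otherwise choose r with m 2ʳ ≤ n < m 2ʳ⁺¹ and m
-- disjoint blocks of 2ʳ coordinates, the coordinates of a block being labelled by the elements of
-- {0,1}ʳ.  The syndrome of u in a block is the sum over 𝔽₂ of the labels of the coordinates at which
-- u is 1: flipping one suitable coordinate of the block makes it 0.  Call u marked if some
-- syndrome of u is 0, and let G consist of the edges of Q n meeting a marked vertex.
--
-- For a missing edge uv in direction i, correct the syndromes of u in m - 1 blocks not containing i:
-- these directions and i span a copy of Q m in which every vertex except u and v is marked.
--
-- Count the edges at their even ends.  For each block, there are at most 2ⁿ⁻ʳ⁻¹ even vertices with
-- syndrome 0, hence fewer than m 2ⁿ edges at them, and every other even vertex has exactly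
-- one neighbour differing in the block with syndrome 0 there, which adds at most 2ⁿ⁻¹ edges.

open import Defs
open import Data.Bool.Base using (Bool; true; false; not; _∧_; _xor_)
open import Data.Bool.Properties
  using (xor-assoc; xor-comm; xor-same; xor-inverseˡ; xor-identityʳ; not-involutive; not-injective
        ; not-¬; ¬-not)
  renaming (_≟_ to _≟ᵇ_)
open import Data.Fin.Base as Fin using (Fin; zero; suc; funToFin; combine; inject≤)
open import Data.Fin.Properties
  using (_≟_; _<?_; any?; <-asym; 2↔Bool; injective⇒≤; finToFun-funToFin; funToFin-finToFin
        ; combine-injective; inject≤-injective)
open import Data.Fin.Subset using (Subset; _∈_; _∪_; ⁅_⁆)
open import Data.Fin.Subset.Properties using (∈⊤; x∈⁅x⁆; x∈p∪q⁺)
open import Data.Integer.Base as ℤ using (+_; +<+)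
import Data.Integer.Properties as ℤ
open import Data.List.Base
  using (List; []; _∷_; _++_; length; lookup; map; filter; allFin; concatMap
        ; cartesianProduct)
open import Data.List.Membership.Propositional renaming (_∈_ to _∈ˡ_) using ()
open import Data.List.Membership.Propositional.Properties
  using (∈-lookup; ∈-map⁺; ∈-map⁻; ∈-filter⁺; ∈-filter⁻; ∈-allFin; ∈-++⁺ˡ; ∈-++⁺ʳ; ∈-concatMap⁺
        ; ∈-cartesianProduct⁺; ∈-cartesianProduct⁻)
open import Data.List.Properties using (length-++; length-map; length-tabulate)
import Data.List.Relation.Unary.All as All
open import Data.List.Relation.Unary.AllPairs using ([]; _∷_)
import Data.List.Relation.Unary.Any as Any
open import Data.List.Relation.Unary.Any.Properties using (lookup-index)
open import Data.List.Relation.Unary.Unique.Propositional using (Unique)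
import Data.List.Relation.Unary.Unique.Propositional.Properties as Unique
open import Data.Nat.Base as ℕ using (ℕ; zero; suc; NonZero; _^_; _≤_; z≤n; s≤s)
  renaming (_<_ to _<ⁿ_; _+_ to _+ⁿ_; _*_ to _*ⁿ_)
import Data.Nat.Properties as ℕ
open import Data.Nat.Tactic.RingSolver using (solve-∀)
open import Data.Product.Base using (∃-syntax; _×_; _,_; proj₁; proj₂)
open import Data.Rational.Base using (_/_; _+_; _*_; _<_; toℚᵘ)
open import Data.Rational.Properties using (toℚᵘ-cancel-<; toℚᵘ-fromℚᵘ; toℚᵘ-homo-+; toℚᵘ-homo-*)
open import Data.Rational.Unnormalised.Base as ℚᵘ using (_≃_)
import Data.Rational.Unnormalised.Properties as ℚᵘ
open import Data.Sum.Base using (_⊎_; inj₁; inj₂; swap; [_,_]′)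
import Data.Vec.Base as Vec
open import Data.Vec.Functional using (foldr; updateAt)
open import Data.Vec.Functional.Properties using (updateAt-updates; updateAt-minimal)
import Data.Vec.Properties as Vec
open import Function.Base using (id; _∘_; it)
open import Function.Bundles using (Equivalence; Inverse; mk⇔)
open import Relation.Binary.PropositionalEquality
  using (_≡_; _≢_; _≗_; refl; sym; trans; cong; cong₂; subst; subst₂; module ≡-Reasoning)
open import Relation.Nullary.Decidable
  using (Dec; yes; no; does; ¬?; _×-dec_; _⊎-dec_; dec-true; dec-false)
open import Relation.Nullary.Negation using (¬_; contradiction)

open Equivalence using (to; from)

-- Comparing lengths of duplicate-free lists.

lookup-injective : ∀ {A : Set} {xs : List A} → Unique xs →
                   ∀ i j → lookup xs i ≡ lookup xs j → i ≡ j
lookup-injective (_  ∷ _)  zero    zero    _  = refl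
lookup-injective (x≢ ∷ _)  zero    (suc j) eq = contradiction eq (All.lookup x≢ (∈-lookup j))
lookup-injective (x≢ ∷ _)  (suc i) zero    eq = contradiction (sym eq) (All.lookup x≢ (∈-lookup i))
lookup-injective (_  ∷ u)  (suc i) (suc j) eq = cong suc (lookup-injective u i j eq)

-- Pigeonhole on positions: position `i` of `xs` is sent to the position in `ys` at which `f` of its
-- entry is found, and this map of indices is injective.
length-≤ : ∀ {A B : Set} {xs : List A} {ys : List B} (f : A → B) → Unique xs →
           (∀ {x y} → x ∈ˡ xs → y ∈ˡ xs → f x ≡ f y → x ≡ y) →
           (∀ {x} → x ∈ˡ xs → f x ∈ˡ ys) → length xs ≤ length ys
length-≤ {xs = xs} {ys} f xs! f-inj f∈ = injective⇒≤ λ {i} {j} eq →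
  lookup-injective xs! i j (f-inj (∈-lookup i) (∈-lookup j)
    (trans (lookup-index (f∈ (∈-lookup i))) (trans (cong (lookup ys) eq)
      (sym (lookup-index (f∈ (∈-lookup j)))))))

-- Prepending the witness `x` to the entries with `P` gives a duplicate-free list, all of whose
-- entries satisfy `Q`.
length-filter-< : ∀ {A : Set} {P Q : A → Set} (P? : ∀ x → Dec (P x)) (Q? : ∀ x → Dec (Q x)) →
                  (∀ {x} → P x → Q x) → ∀ {xs x} → Unique xs → x ∈ˡ xs → Q x → ¬ P x →
                  length (filter P? xs) <ⁿ length (filter Q? xs)
length-filter-< P? Q? P⇒Q {xs} {x} xs! x∈ qx ¬px = length-≤ id
  (All.tabulate (λ y∈ x≡y → ¬px (subst _ (sym x≡y) (proj₂ (∈-filter⁻ P? {xs = xs} y∈))))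
    ∷ Unique.filter⁺ P? xs!)
  (λ _ _ eq → eq)
  λ { (Any.here refl) → ∈-filter⁺ Q? x∈ qx
    ; (Any.there y∈)  → let (y∈xs , py) = ∈-filter⁻ P? {xs = xs} y∈ in ∈-filter⁺ Q? y∈xs (P⇒Q py) }

length-cartesianProduct : ∀ {A B : Set} (xs : List A) (ys : List B) →
                          length (cartesianProduct xs ys) ≡ length xs *ⁿ length ys
length-cartesianProduct []       ys = refl
length-cartesianProduct (x ∷ xs) ys = trans (length-++ (map (x ,_) ys))
  (cong₂ _+ⁿ_ (length-map (x ,_) ys) (length-cartesianProduct xs ys))

length-concatMap-≤ : ∀ {A B : Set} (f : A → List B) {b} → (∀ x → length (f x) ≤ b) →
                     ∀ xs → length (concatMap f xs) ≤ length xs *ⁿ b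
length-concatMap-≤ f f≤ []       = z≤n
length-concatMap-≤ f f≤ (x ∷ xs) = ℕ.≤-trans (ℕ.≤-reflexive (length-++ (f x)))
  (ℕ.+-mono-≤ (f≤ x) (length-concatMap-≤ f f≤ xs))

-- Sums over 𝔽₂.

⨁ : ∀ {n} → (Fin n → Bool) → Bool
⨁ = foldr _xor_ false

⨁-cong : ∀ {n} {f g : Fin n → Bool} → f ≗ g → ⨁ f ≡ ⨁ g
⨁-cong {zero}  _   = refl
⨁-cong {suc n} f≗g = cong₂ _xor_ (f≗g zero) (⨁-cong (f≗g ∘ suc))

⨁-update : ∀ {n} {f g : Fin n → Bool} c → (∀ k → k ≢ c → g k ≡ f k) →
           ⨁ g ≡ (g c xor f c) xor ⨁ f
⨁-update {suc n} {f} {g} zero eq = begin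
  g zero xor ⨁ (g ∘ suc)                           ≡⟨ cong (g zero xor_) (⨁-cong λ k → eq (suc k) λ ()) ⟩
  g zero xor ⨁ (f ∘ suc)                           ≡⟨ cong (λ b → g zero xor (b xor ⨁ (f ∘ suc))) (xor-same (f zero)) ⟨
  g zero xor ((f zero xor f zero) xor ⨁ (f ∘ suc)) ≡⟨ cong (g zero xor_) (xor-assoc (f zero) (f zero) _) ⟩
  g zero xor (f zero xor ⨁ f)                      ≡⟨ xor-assoc (g zero) (f zero) _ ⟨
  (g zero xor f zero) xor ⨁ f                      ∎
  where open ≡-Reasoning
⨁-update {suc n} {f} {g} (suc c) eq = begin
  g zero xor ⨁ (g ∘ suc)             ≡⟨ cong₂ _xor_ (eq zero λ ())
                                          (⨁-update c λ k k≢c → eq (suc k) λ { refl → k≢c refl }) ⟩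
  f zero xor (d xor ⨁ (f ∘ suc))     ≡⟨ xor-assoc (f zero) d _ ⟨
  (f zero xor d) xor ⨁ (f ∘ suc)     ≡⟨ cong (_xor _) (xor-comm (f zero) d) ⟩
  (d xor f zero) xor ⨁ (f ∘ suc)     ≡⟨ xor-assoc d (f zero) _ ⟩
  d xor ⨁ f                          ∎
  where
  open ≡-Reasoning
  d = g (suc c) xor f (suc c)

xor-cancelˡ : ∀ a {b c} → a xor b ≡ a xor c → b ≡ c
xor-cancelˡ false eq = eq
xor-cancelˡ true  eq = not-injective eq

xor-cancelʳ : ∀ {a b} c → a xor c ≡ b xor c → a ≡ b
xor-cancelʳ {a} {b} c eq = xor-cancelˡ c (trans (xor-comm c a) (trans eq (xor-comm b c)))

-- Vertices of the hypercube as bit vectors, and edges as flips of one bit.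

funToFin-cong : ∀ {m n} {f g : Fin m → Fin n} → f ≗ g → funToFin f ≡ funToFin g
funToFin-cong {zero}  _   = refl
funToFin-cong {suc m} f≗g = cong₂ combine (f≗g zero) (funToFin-cong (f≗g ∘ suc))

-- Opaque, so that the dimension n can be inferred from bit and fromBits; it
-- cannot be inferred from the type Fin (2 ^ n).
opaque
  bit : ∀ {n} → Fin (2 ^ n) → Fin n → Bool
  bit {n} u i = Inverse.to 2↔Bool (coordinate n u i)

  fromBits : ∀ {n} → (Fin n → Bool) → Fin (2 ^ n)
  fromBits g = funToFin (Inverse.from 2↔Bool ∘ g)

  bit-fromBits : ∀ {n} (g : Fin n → Bool) → bit (fromBits g) ≗ g
  bit-fromBits {n} g i = trans
    (cong (Inverse.to 2↔Bool) (finToFun-funToFin {n} (Inverse.from 2↔Bool ∘ g) i))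
    (Inverse.strictlyInverseˡ 2↔Bool (g i))

  bit-cong : ∀ {n} {u v : Fin (2 ^ n)} {i : Fin n} → coordinate n u i ≡ coordinate n v i →
             bit u i ≡ bit v i
  bit-cong = cong (Inverse.to 2↔Bool)

  bit-cong⁻ : ∀ {n} {u v : Fin (2 ^ n)} {i : Fin n} → bit u i ≡ bit v i →
              coordinate n u i ≡ coordinate n v i
  bit-cong⁻ {n} {u} {v} {i} eq = trans
    (sym (Inverse.strictlyInverseʳ 2↔Bool (coordinate n u i)))
    (trans (cong (Inverse.from 2↔Bool) eq) (Inverse.strictlyInverseʳ 2↔Bool (coordinate n v i)))

  flip : ∀ {n} → Fin n → Fin (2 ^ n) → Fin (2 ^ n)
  flip i u = fromBits (updateAt (bit u) i not)

  bit-flip-≡ : ∀ {n} (i : Fin n) (u : Fin (2 ^ n)) → bit (flip i u) i ≡ not (bit u i)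
  bit-flip-≡ i u = trans (bit-fromBits _ i) (updateAt-updates i (bit u))

  bit-flip-≢ : ∀ {n} {i k : Fin n} (u : Fin (2 ^ n)) → k ≢ i → bit (flip i u) k ≡ bit u k
  bit-flip-≢ {_} {i} {k} u k≢i = trans (bit-fromBits _ k) (updateAt-minimal k i (bit u) k≢i)

bit-injective : ∀ {n} {u v : Fin (2 ^ n)} → (∀ (i : Fin n) → bit u i ≡ bit v i) → u ≡ v
bit-injective {n} {u} {v} eq = trans (sym (funToFin-finToFin {n} u))
  (trans (funToFin-cong (λ i → bit-cong⁻ (eq i))) (funToFin-finToFin {n} v))

flip-unique : ∀ {n} {u v : Fin (2 ^ n)} (i : Fin n) → bit v i ≡ not (bit u i) →
              (∀ k → k ≢ i → bit v k ≡ bit u k) → v ≡ flip i u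
flip-unique {u = u} {v} i at off = bit-injective eq
  where
  eq : ∀ k → bit v k ≡ bit (flip i u) k
  eq k with k ≟ i
  ... | yes refl = trans at (sym (bit-flip-≡ i u))
  ... | no k≢i   = trans (off k k≢i) (sym (bit-flip-≢ u k≢i))

flip-involutive : ∀ {n} (i : Fin n) (u : Fin (2 ^ n)) → flip i (flip i u) ≡ u
flip-involutive i u = sym (flip-unique i
  (sym (trans (cong not (bit-flip-≡ i u)) (not-involutive _)))
  (λ k k≢i → sym (bit-flip-≢ u k≢i)))

flip-injective : ∀ {n} (i : Fin n) {u v : Fin (2 ^ n)} → flip i u ≡ flip i v → u ≡ v
flip-injective i {u} {v} eq =
  trans (sym (flip-involutive i u)) (trans (cong (flip i) eq) (flip-involutive i v))

flip-adj : ∀ {n} (i : Fin n) (u : Fin (2 ^ n)) → DifferInOne n u (flip i u)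
flip-adj {n} i u = i
  , (λ eq → not-¬ refl (trans (bit-cong eq) (bit-flip-≡ i u)))
  , unique
  where
  unique : ∀ {k} → coordinate n u k ≢ coordinate n (flip i u) k → i ≡ k
  unique {k} ≢ with i ≟ k
  ... | yes i≡k = i≡k
  ... | no i≢k  = contradiction
    (bit-cong⁻ (sym (bit-flip-≢ u (i≢k ∘ sym)))) ≢

adj-flip : ∀ {n} {u v : Fin (2 ^ n)} → DifferInOne n u v → ∃[ i ] v ≡ flip i u
adj-flip {n} {u} {v} (i , differ , unique) = i , flip-unique i
  (¬-not λ eq → differ (bit-cong⁻ (sym eq)))
  same
  where
  same : ∀ k → k ≢ i → bit v k ≡ bit u k
  same k k≢i with bit v k ≟ᵇ bit u k
  ... | yes eq = eq
  ... | no ≢   = contradiction (sym (unique λ eq → ≢ (bit-cong (sym eq)))) k≢i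

-- Copies obtained as images of injective maps.

imageGraph : ∀ {k N} (F : Graph k) (f : Fin k → Fin N) → (∀ x y → f x ≡ f y → x ≡ y) → Graph N
imageGraph F f f-inj = record
  { Adj    = λ p q → ∃[ x ] ∃[ y ] (f x ≡ p × f y ≡ q × Adj F x y)
  ; adj?   = λ p q → any? λ x → any? λ y → f x ≟ p ×-dec f y ≟ q ×-dec adj? F x y
  ; symm   = λ (x , y , fx , fy , a) → y , x , fy , fx , symm F a
  ; irrefl = λ { refl (x , y , fx , fy , a) → irrefl F (f-inj x y (trans fx (sym fy))) a }
  }

-- The adjacency rows are those of `whole`, so that `whole-edge` describes them; the vertex set of
-- `whole` would be everything and is therefore replaced by the image of `f`.
imageSubgraph : ∀ {k N} {F : Graph k} {f : Fin k → Fin N} → (∀ x y → f x ≡ f y → x ≡ y) → Subgraph N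
imageSubgraph {F = F} {f} f-inj =
  ⟨ Vec.tabulate (λ v → does (any? λ x → f x ≟ v)) , neighbours (whole (imageGraph F f f-inj)) ⟩

module _ {k N} (F : Graph k) {f : Fin k → Fin N} (f-inj : ∀ x y → f x ≡ f y → x ≡ y) where

  private
    K = imageGraph F f f-inj
    H : Subgraph N
    H = imageSubgraph {F = F} f-inj

  ∈-image⁺ : ∀ x → f x ∈ vertices H
  ∈-image⁺ x = Vec.lookup⇒[]= (f x) _
    (trans (Vec.lookup∘tabulate _ (f x)) (dec-true (any? λ y → f y ≟ f x) (x , refl)))

  ∈-image⁻ : ∀ {v} → v ∈ vertices H → ∃[ x ] f x ≡ v
  ∈-image⁻ {v} v∈
    with any? (λ x → f x ≟ v)
       | trans (sym (Vec.lookup∘tabulate (λ v → does (any? λ x → f x ≟ v)) v)) (Vec.[]=⇒lookup v∈)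
  ... | yes p | _ = p
  ... | no _  | ()

  image-≅ : F ≅ H
  image-≅ = f , record
    { injective = f-inj
    ; image     = λ v → mk⇔ ∈-image⁻ λ { (x , refl) → ∈-image⁺ x }
    ; edges     = λ x y → mk⇔
        (λ a → from (whole-edge K (f x) (f y)) (x , y , refl , refl , a))
        (λ e → let (x′ , y′ , fx , fy , a) = to (whole-edge K (f x) (f y)) e
               in subst (λ z → Adj F z y) (f-inj x′ x fx) (subst (Adj F x′) (f-inj y′ y fy) a))
    }

  image-copy : ∀ G → (∀ x → f x ∈ vertices G) → (∀ x y → Adj F x y → Edge G (f x) (f y)) →
               IsCopyIn F G H
  image-copy G f∈ f-edge = record
    { simple = record
      { edge-sym      = edge-sym K-simple
      ; edge-irrefl   = edge-irrefl K-simple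
      ; edge-incident = λ p q e → let (x , _ , fx , _) = to (whole-edge K p q) e
                                  in subst (_∈ vertices H) fx (∈-image⁺ x)
      }
    ; ⊑G     = record
      { vertices-⊆ = λ v v∈ → let (x , fx) = ∈-image⁻ v∈ in subst (_∈ vertices G) fx (f∈ x)
      ; edges-⊆    = λ p q e → fromAdj (to (whole-edge K p q) e)
      }
    ; iso    = image-≅
    }
    where
    K-simple = simple (subgraph (whole-semiSaturated K F))

    fromAdj : ∀ {p q} → Adj K p q → Edge G p q
    fromAdj (x , y , refl , refl , a) = f-edge x y a

⊑-trans : ∀ {N} {H G G′ : Subgraph N} → H ⊑ G → G ⊑ G′ → H ⊑ G′
⊑-trans p q = record
  { vertices-⊆ = λ u → vertices-⊆ q u ∘ vertices-⊆ p u
  ; edges-⊆    = λ u v → edges-⊆ q u v ∘ edges-⊆ p u v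
  }

-- Copies in `G` remain copies in `G′`. The image of `f` is a further one: it lies in `G′`, but one
-- of its edges is missing from `G`.
#copies-< : ∀ {k N} (F : Graph k) {G G′ : Subgraph N} {f : Fin k → Fin N} →
            G ⊑ G′ → (∀ x y → f x ≡ f y → x ≡ y) → (∀ x → f x ∈ vertices G′) →
            (∀ x y → Adj F x y → Edge G′ (f x) (f y)) →
            ∀ {x y} → Adj F x y → ¬ Edge G (f x) (f y) →
            #copies F G <ⁿ #copies F G′
#copies-< {N = N} F {G} {G′} G⊑G′ f-inj f∈ f-edge {x} {y} a ¬e =
  length-filter-< (isCopyIn? F G) (isCopyIn? F G′)
    (λ c → record
      { simple = IsCopyIn.simple c
      ; ⊑G     = ⊑-trans (IsCopyIn.⊑G c) G⊑G′
      ; iso    = IsCopyIn.iso c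
      })
    (allSubgraphs-unique N) (allSubgraphs-complete _)
    (image-copy F f-inj G′ f∈ f-edge)
    (λ c → ¬e (edges-⊆ (IsCopyIn.⊑G c) _ _ (to (edges (proj₂ (image-≅ F f-inj)) x y) a)))

-- Adding an edge.

∈-updateAt-∪⁺ : ∀ {N} (E : Vec.Vec (Subset N) N) i s p {q} → q ∈ Vec.lookup E p →
                q ∈ Vec.lookup (Vec.updateAt E i (_∪ s)) p
∈-updateAt-∪⁺ E i s p q∈ with p ≟ i
... | yes refl = subst (_ ∈_) (sym (Vec.lookup∘updateAt i E)) (x∈p∪q⁺ (inj₁ q∈))
... | no p≢i   = subst (_ ∈_) (sym (Vec.lookup∘updateAt′ p i p≢i E)) q∈

∈-updateAt-∪-new : ∀ {N} (E : Vec.Vec (Subset N) N) i j → j ∈ Vec.lookup (Vec.updateAt E i (_∪ ⁅ j ⁆)) i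
∈-updateAt-∪-new E i j =
  subst (j ∈_) (sym (Vec.lookup∘updateAt i E)) (x∈p∪q⁺ (inj₂ (x∈⁅x⁆ j)))

module _ {N} (u v : Fin N) (G : Subgraph N) where

  private
    E = Vec.updateAt (neighbours G) u (_∪ ⁅ v ⁆)

  addEdge-⊒ : G ⊑ addEdge u v G
  addEdge-⊒ = record
    { vertices-⊆ = λ _ w∈ → x∈p∪q⁺ (inj₁ w∈)
    ; edges-⊆    = λ p q e → ∈-updateAt-∪⁺ E v ⁅ u ⁆ p (∈-updateAt-∪⁺ (neighbours G) u ⁅ v ⁆ p e)
    }

  addEdge-edge : Edge (addEdge u v G) u v
  addEdge-edge = ∈-updateAt-∪⁺ E v ⁅ u ⁆ u (∈-updateAt-∪-new (neighbours G) u v)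

  addEdge-edge˘ : Edge (addEdge u v G) v u
  addEdge-edge˘ = ∈-updateAt-∪-new E v u

-- Subcubes.

-- The subcube of Q n through u spanned by the directions d, the origin of Q m going to u.
module _ {m n} (u : Fin (2 ^ n)) (d : Fin m → Fin n) where

  corner : Fin (2 ^ m) → Fin (2 ^ n)
  corner x = fromBits λ k → does (any? λ a → d a ≟ k ×-dec bit x a ≟ᵇ true) xor bit u k

  bit-corner-∉ : ∀ x {k} → (∀ a → d a ≢ k) → bit (corner x) k ≡ bit u k
  bit-corner-∉ x {k} d≢k = trans (bit-fromBits _ k) (cong (_xor bit u k)
    (dec-false (any? λ a → d a ≟ k ×-dec bit x a ≟ᵇ true) λ (a , da≡k , _) → d≢k a da≡k))

  module _ (d-inj : ∀ a b → d a ≡ d b → a ≡ b) where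

    bit-corner : ∀ x a → bit (corner x) (d a) ≡ bit x a xor bit u (d a)
    bit-corner x a = trans (bit-fromBits _ (d a)) (cong (_xor bit u (d a)) eq)
      where
      flipped? = any? λ b → d b ≟ d a ×-dec bit x b ≟ᵇ true

      eq : does flipped? ≡ bit x a
      eq with bit x a in xₐ
      ... | true  = dec-true flipped? (a , refl , xₐ)
      ... | false = dec-false flipped? λ (b , db≡da , x_b) →
        contradiction (trans (sym xₐ) (trans (cong (bit x) (d-inj a b (sym db≡da))) x_b)) λ ()

    corner-injective : ∀ x y → corner x ≡ corner y → x ≡ y
    corner-injective x y eq = bit-injective λ a → xor-cancelʳ (bit u (d a))
      (trans (sym (bit-corner x a)) (trans (cong (λ w → bit w (d a)) eq) (bit-corner y a)))

    corner-flip : ∀ a x → corner (flip a x) ≡ flip (d a) (corner x)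
    corner-flip a x = flip-unique (d a)
      (trans (bit-corner (flip a x) a) (trans (cong (_xor bit u (d a)) (bit-flip-≡ a x))
        (trans (not-xor (bit x a)) (cong not (sym (bit-corner x a))))))
      off
      where
      not-xor : ∀ b {c} → not b xor c ≡ not (b xor c)
      not-xor true  = sym (not-involutive _)
      not-xor false = refl

      off : ∀ k → k ≢ d a → bit (corner (flip a x)) k ≡ bit (corner x) k
      off k k≢ with any? (λ b → d b ≟ k)
      ... | no ∄          = trans (bit-corner-∉ (flip a x) (λ b db → ∄ (b , db)))
                                  (sym (bit-corner-∉ x (λ b db → ∄ (b , db))))
      ... | yes (b , refl) = trans (bit-corner (flip a x) b) (trans
        (cong (_xor bit u (d b)) (bit-flip-≢ x λ { refl → k≢ refl }))
        (sym (bit-corner x b)))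

    corner-origin : ∀ x → (∀ a → bit x a ≡ false) → corner x ≡ u
    corner-origin x x≡0 = bit-injective same
      where
      same : ∀ k → bit (corner x) k ≡ bit u k
      same k with any? (λ b → d b ≟ k)
      ... | no ∄           = bit-corner-∉ x (λ b db → ∄ (b , db))
      ... | yes (b , refl) = trans (bit-corner x b) (cong (_xor bit u (d b)) (x≡0 b))

-- Parity classes, and counting edges at their even ends.

parity : ∀ n → Fin (2 ^ n) → Bool
parity n u = ⨁ (bit {n} u)

parity-flip : ∀ {n} (i : Fin n) (u : Fin (2 ^ n)) → parity n (flip i u) ≡ not (parity n u)
parity-flip {n} i u = trans (⨁-update i (λ k → bit-flip-≢ u))
  (cong (_xor parity n u) (trans (cong (_xor bit u i) (bit-flip-≡ i u)) (xor-inverseˡ (bit u i))))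

parityClass : ∀ n → Bool → List (Fin (2 ^ n))
parityClass n b = filter (λ v → parity n v ≟ᵇ b) (allFin (2 ^ n))

parityClass-unique : ∀ n b → Unique (parityClass n b)
parityClass-unique n b = Unique.filter⁺ (λ v → parity n v ≟ᵇ b) (Unique.allFin⁺ (2 ^ n))

∈-parityClass⁺ : ∀ n {b} {v : Fin (2 ^ n)} → parity n v ≡ b → v ∈ˡ parityClass n b
∈-parityClass⁺ n {b} {v} = ∈-filter⁺ (λ v → parity n v ≟ᵇ b) (∈-allFin v)

∈-parityClass⁻ : ∀ n {b} {v : Fin (2 ^ n)} → v ∈ˡ parityClass n b → parity n v ≡ b
∈-parityClass⁻ n {b} v∈ = proj₂ (∈-filter⁻ (λ v → parity n v ≟ᵇ b) {xs = allFin (2 ^ n)} v∈)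

length-allFin : ∀ n → length (allFin n) ≡ n
length-allFin n = length-tabulate id

-- Flipping bit `i` maps the class injectively to vertices outside it. The argument `i` also ensures
-- that n is positive: for n = 0 the only vertex is even and the bound fails.
length-parityClass : ∀ {n} → Fin n → ∀ b → 2 *ⁿ length (parityClass n b) ≤ 2 ^ n
length-parityClass {n} i b = begin
  2 *ⁿ length C                       ≡⟨ cong (length C +ⁿ_) (ℕ.+-identityʳ _) ⟩
  length C +ⁿ length C                ≡⟨ cong (length C +ⁿ_) (length-map (flip i) C) ⟨
  length C +ⁿ length (map (flip i) C) ≡⟨ length-++ C ⟨
  length (C ++ map (flip i) C)        ≤⟨ length-≤ id
    (Unique.++⁺ C! (Unique.map⁺ (flip-injective i) C!) disjoint) (λ _ _ eq → eq) (λ _ → ∈-allFin _) ⟩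
  length (allFin (2 ^ n))             ≡⟨ length-allFin (2 ^ n) ⟩
  2 ^ n                               ∎
  where
  open ℕ.≤-Reasoning
  C = parityClass n b
  C! = parityClass-unique n b

  disjoint : ∀ {v} → ¬ (v ∈ˡ C × v ∈ˡ map (flip i) C)
  disjoint (v∈ , v∈′) with ∈-map⁻ (flip i) v∈′
  ... | w , w∈ , refl = not-¬ (trans (∈-parityClass⁻ n v∈) (sym (∈-parityClass⁻ n w∈))) (parity-flip i w)

-- Every edge has exactly one even end, so it is determined by that end and its direction. Since
-- `#edges` counts pairs in increasing order, `increasing` sorts the two ends.
#edges-≤ : ∀ {n} {G : Subgraph (2 ^ n)} → G IsSubgraphOf Q n → (ps : List (Fin (2 ^ n) × Fin n)) →
           (∀ v i → parity n v ≡ false → Edge G v (flip i v) → (v , i) ∈ˡ ps) →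
           #edges G ≤ length ps
#edges-≤ {n} {G} G⊆Q ps covers = ℕ.≤-trans
  (length-≤ id
    (Unique.filter⁺ edge<? (Unique.cartesianProduct⁺ (Unique.allFin⁺ _) (Unique.allFin⁺ _)))
    (λ _ _ eq → eq)
    (λ e∈ → let (u<v , e) = proj₂ (∈-filter⁻ edge<? {xs = cartesianProduct (allFin _) (allFin _)} e∈)
            in listed u<v e (adj-flip {n} (edge⇒adj G⊆Q _ _ e))))
  (ℕ.≤-reflexive (length-map increasing ps))
  where
  edge<? : (e : Fin (2 ^ n) × Fin (2 ^ n)) → Dec (proj₁ e Fin.< proj₂ e × Edge G (proj₁ e) (proj₂ e))
  edge<? (u , v) = u <? v ×-dec edge? G u v

  increasing : Fin (2 ^ n) × Fin n → Fin (2 ^ n) × Fin (2 ^ n)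
  increasing (v , i) with v <? flip i v
  ... | yes _ = v , flip i v
  ... | no _  = flip i v , v

  increasing-< : ∀ {v i} → v Fin.< flip i v → increasing (v , i) ≡ (v , flip i v)
  increasing-< {v} {i} lt with v <? flip i v
  ... | yes _ = refl
  ... | no ≮  = contradiction lt ≮

  increasing-> : ∀ {v i} → flip i v Fin.< v → increasing (v , i) ≡ (flip i v , v)
  increasing-> {v} {i} gt with v <? flip i v
  ... | yes lt = contradiction gt (<-asym lt)
  ... | no _   = refl

  listed : ∀ {u v} → u Fin.< v → Edge G u v → ∃[ i ] v ≡ flip i u → (u , v) ∈ˡ map increasing ps
  listed {u} u<v e (i , refl) with parity n u in par
  ... | false = subst (_∈ˡ map increasing ps) (increasing-< u<v)
                  (∈-map⁺ increasing (covers u i par e))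
  -- Here `u` is odd, so the covering pair starts at the other end `w`, and flipping `w` in the same
  -- direction leads back to `u`.
  ... | true  = subst (_∈ˡ map increasing ps)
    (trans (increasing-> (subst (Fin._< w) (sym wu) u<v)) (cong (_, w) wu))
    (∈-map⁺ increasing (covers w i (trans (parity-flip i u) (cong not par))
      (subst (Edge G w) (sym wu) (edge-sym (simple G⊆Q) u w e))))
    where
    w = flip i u
    wu = flip-involutive i u

-- Blocks of coordinates and their syndromes.

origin : ∀ n → Fin (2 ^ n)
origin n = fromBits {n} λ _ → false

bit-origin : ∀ {n} (k : Fin n) → bit (origin n) k ≡ false
bit-origin = bit-fromBits _

-- Block j consists of the coordinates dir j c, one for every label c ∈ {0,1}ʳ.
module Blocks {n m r : ℕ} (dir : Fin m → Fin (2 ^ r) → Fin n)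
  (dir-injective : ∀ {j c j′ c′} → dir j c ≡ dir j′ c′ → j ≡ j′ × c ≡ c′) where

  -- This is the syndrome of the Hamming code with one extra column, the zero label. Because of that
  -- column every syndrome, even 0, is sent to 0 by flipping exactly one coordinate of the block.
  syndrome : Fin m → Fin (2 ^ n) → Fin (2 ^ r)
  syndrome j u = fromBits {r} λ k → ⨁ λ c → bit u (dir j c) ∧ bit c k

  syndrome-cong : ∀ j {u v} → (∀ c → bit v (dir j c) ≡ bit u (dir j c)) → syndrome j v ≡ syndrome j u
  syndrome-cong j eq = bit-injective λ k → trans (bit-fromBits _ k)
    (trans (⨁-cong λ c → cong (_∧ bit c k) (eq c)) (sym (bit-fromBits _ k)))

  -- Only the summand of `c` changes, and it changes by the label `c`. The hypotheses concern block
  -- `j` alone, since corners of a subcube may differ from `u` in several blocks at once.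
  syndrome-toggle : ∀ j c {u v} → bit v (dir j c) ≡ not (bit u (dir j c)) →
                    (∀ c′ → c′ ≢ c → bit v (dir j c′) ≡ bit u (dir j c′)) →
                    ∀ (k : Fin r) → bit (syndrome j v) k ≡ bit c k xor bit (syndrome j u) k
  syndrome-toggle j c {u} {v} at off k = begin
    bit (syndrome j v) k             ≡⟨ bit-fromBits {r} _ k ⟩
    ⨁ (summand v)                    ≡⟨ ⨁-update c (λ c′ c′≢c → cong (_∧ bit {r} c′ k) (off c′ c′≢c)) ⟩
    (summand v c xor summand u c) xor ⨁ (summand u)
      ≡⟨ cong₂ _xor_ (trans (cong (λ b → (b ∧ bit {r} c k) xor summand u c) at) (toggle (bit u (dir j c))))
                     (sym (bit-fromBits {r} _ k)) ⟩
    bit c k xor bit (syndrome j u) k ∎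
    where
    open ≡-Reasoning
    summand : Fin (2 ^ n) → Fin (2 ^ r) → Bool
    summand w c = bit w (dir j c) ∧ bit {r} c k

    toggle : ∀ a {b} → (not a ∧ b) xor (a ∧ b) ≡ b
    toggle true  = refl
    toggle false = xor-identityʳ _

  syndrome-flip : ∀ j c u (k : Fin r) →
                  bit (syndrome j (flip (dir j c) u)) k ≡ bit c k xor bit (syndrome j u) k
  syndrome-flip j c u = syndrome-toggle j c (bit-flip-≡ (dir j c) u)
    λ c′ c′≢c → bit-flip-≢ u λ eq → c′≢c (proj₂ (dir-injective eq))

  syndrome-flip-∉ : ∀ j {i} → (∀ c → dir j c ≢ i) → ∀ u → syndrome j (flip i u) ≡ syndrome j u
  syndrome-flip-∉ j i∉ u = syndrome-cong j λ c → bit-flip-≢ u (i∉ c)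

  codewords : Fin m → List (Fin (2 ^ n))
  codewords j = filter (λ v → syndrome j v ≟ origin r) (parityClass n false)

  ∈-codewords⁺ : ∀ {j v} → parity n v ≡ false → syndrome j v ≡ origin r → v ∈ˡ codewords j
  ∈-codewords⁺ {j} even = ∈-filter⁺ (λ v → syndrome j v ≟ origin r) (∈-parityClass⁺ n even)

  ∈-codewords⁻ : ∀ {j v} → v ∈ˡ codewords j → parity n v ≡ false × syndrome j v ≡ origin r
  ∈-codewords⁻ {j} v∈ =
    let (v∈C , s) = ∈-filter⁻ (λ v → syndrome j v ≟ origin r) {xs = parityClass n false} v∈
    in ∈-parityClass⁻ n v∈C , s

  -- Flipping the coordinate labelled c in block j turns the syndrome of a codeword into c, so
  -- that the 2ʳ odd neighbours obtained in this way are distinct for all codewords.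
  length-codewords : ∀ j → length (codewords j) *ⁿ 2 ^ r ≤ length (parityClass n true)
  length-codewords j = ℕ.≤-trans (ℕ.≤-reflexive (sym (trans
      (length-cartesianProduct (codewords j) (allFin (2 ^ r)))
      (cong (length (codewords j) *ⁿ_) (length-allFin (2 ^ r))))))
    (length-≤ neighbour
      (Unique.cartesianProduct⁺ (Unique.filter⁺ _ (parityClass-unique n false)) (Unique.allFin⁺ (2 ^ r)))
      (λ p∈ q∈ → neighbour-injective (proj₂ (∈⁻ p∈)) (proj₂ (∈⁻ q∈)))
      (λ {(v , c)} p∈ → ∈-parityClass⁺ n (trans (parity-flip (dir j c) v) (cong not (proj₁ (∈⁻ p∈))))))
    where
    neighbour : Fin (2 ^ n) × Fin (2 ^ r) → Fin (2 ^ n)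
    neighbour (v , c) = flip (dir j c) v

    ∈⁻ : ∀ {p} → p ∈ˡ cartesianProduct (codewords j) (allFin (2 ^ r)) →
         parity n (proj₁ p) ≡ false × syndrome j (proj₁ p) ≡ origin r
    ∈⁻ p∈ = ∈-codewords⁻ (proj₁ (∈-cartesianProduct⁻ (codewords j) (allFin (2 ^ r)) p∈))

    label : ∀ {v} c → syndrome j v ≡ origin r → syndrome j (flip (dir j c) v) ≡ c
    label {v} c s = bit-injective λ k → trans (syndrome-flip j c v k)
      (trans (cong (bit {r} c k xor_) (trans (cong (λ w → bit {r} w k) s) (bit-origin k))) (xor-identityʳ _))

    neighbour-injective : ∀ {p q} → syndrome j (proj₁ p) ≡ origin r → syndrome j (proj₁ q) ≡ origin r →
                          neighbour p ≡ neighbour q → p ≡ q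
    neighbour-injective {v , c} {w , c′} sv sw eq
      with trans (sym (label c sv)) (trans (cong (syndrome j) eq) (label c′ sw))
    ... | refl = cong (_, c) (flip-injective (dir j c) eq)

  -- The graph of edges at marked vertices.

  Marked : Fin (2 ^ n) → Set
  Marked u = ∃[ j ] syndrome j u ≡ origin r

  marked? : ∀ u → Dec (Marked u)
  marked? u = any? λ j → syndrome j u ≟ origin r

  markedGraph : Graph (2 ^ n)
  markedGraph = record
    { Adj    = λ u v → DifferInOne n u v × (Marked u ⊎ Marked v)
    ; adj?   = λ u v → differInOne? n u v ×-dec (marked? u ⊎-dec marked? v)
    ; symm   = λ (a , mk) → symm (Q n) a , swap mk
    ; irrefl = λ eq (a , _) → irrefl (Q n) eq a
    }

  G : Subgraph (2 ^ n)
  G = whole markedGraph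

  G⊆Q : G IsSubgraphOf Q n
  G⊆Q = record
    { simple   = simple (subgraph (whole-semiSaturated markedGraph (Q n)))
    ; edge⇒adj = λ u v e → proj₁ (to (whole-edge markedGraph u v) e)
    }

  -- The first list has all edges at even vertices with syndrome 0. The second has, for each even
  -- vertex, the one edge whose flip inside block `j` produces syndrome 0. The overlap of the two is
  -- harmless for an upper bound.
  evenEndsIn : Fin m → List (Fin (2 ^ n) × Fin n)
  evenEndsIn j = cartesianProduct (codewords j) (allFin n)
                 ++ map (λ v → v , dir j (syndrome j v)) (parityClass n false)

  evenEnds : List (Fin (2 ^ n) × Fin n)
  evenEnds = concatMap evenEndsIn (allFin m)

  ∈-evenEnds : ∀ v i → parity n v ≡ false → Edge G v (flip i v) → (v , i) ∈ˡ evenEnds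
  ∈-evenEnds v i even e = ∈-concatMap⁺ _ (locate (proj₂ (to (whole-edge markedGraph v (flip i v)) e)))
    where
    Listed : Fin m → Set
    Listed j = (v , i) ∈ˡ evenEndsIn j

    at : ∀ {j} → Listed j → Any.Any Listed (allFin m)
    at {j} l = Any.map (λ { refl → l }) (∈-allFin j)

    codeword : ∀ {j} → syndrome j v ≡ origin r → Listed j
    codeword s = ∈-++⁺ˡ (∈-cartesianProduct⁺ (∈-codewords⁺ even s) (∈-allFin i))

    locate : Marked v ⊎ Marked (flip i v) → Any.Any Listed (allFin m)
    locate (inj₁ (j , s)) = at (codeword s)
    locate (inj₂ (j , s)) with any? (λ c → dir j c ≟ i)
    -- The flip does not touch block `j`, so `v` already has syndrome 0 there.
    ... | no ∄           = at (codeword (trans (sym (syndrome-flip-∉ j (λ c eq → ∄ (c , eq)) v)) s))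
    -- The flip adds `c` to the syndrome; as the result is 0, the label `c` must be the syndrome of
    -- `v`.
    ... | yes (c , refl) = at {j} (∈-++⁺ʳ (cartesianProduct (codewords j) (allFin n))
      (subst (λ c → (v , dir j c) ∈ˡ map (λ v → v , dir j (syndrome j v)) (parityClass n false)) corrects
        (∈-map⁺ _ (∈-parityClass⁺ n even))))
      where
      corrects : syndrome j v ≡ c
      corrects = bit-injective λ k → sym (xor≡false (bit {r} c k)
        (trans (sym (syndrome-flip j c v k)) (trans (cong (λ w → bit {r} w k) s) (bit-origin k))))
        where
        xor≡false : ∀ a {b} → a xor b ≡ false → a ≡ b
        xor≡false false eq = sym eq
        xor≡false true  eq = sym (not-injective eq)

  -- Completing a missing edge to a subcube.

  -- Blocks are disjoint, so `i` lies in at most one of them, which is taken as `s`. If `i` lies in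
  -- none, the default `j₀` serves.
  spare : Fin m → ∀ i → ∃[ s ] (∀ j c → j ≢ s → dir j c ≢ i)
  spare j₀ i with any? (λ j → any? λ c → dir j c ≟ i)
  ... | yes (s , c , refl) = s , λ j c′ j≢s eq → j≢s (proj₁ (dir-injective eq))
  ... | no ∄               = j₀ , λ j c _ eq → ∄ (j , c , eq)

  -- The edge in direction i at an unmarked vertex u is completed to the subcube through u spanned by
  -- i and by the directions correcting the syndromes of u in the blocks other than s, none of which
  -- contains i: all corners of this subcube off that edge are marked.
  module Completion (u : Fin (2 ^ n)) (i : Fin n) (s : Fin m)
    (s-spare : ∀ j c → j ≢ s → dir j c ≢ i) where

    direction : Fin m → Fin n
    direction j with j ≟ s
    ... | yes _ = i
    ... | no _  = dir j (syndrome j u)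

    direction-s : direction s ≡ i
    direction-s with s ≟ s
    ... | yes _  = refl
    ... | no s≢s = contradiction refl s≢s

    direction-≢ : ∀ {j} → j ≢ s → direction j ≡ dir j (syndrome j u)
    direction-≢ {j} j≢s with j ≟ s
    ... | yes j≡s = contradiction j≡s j≢s
    ... | no _    = refl

    -- The direction in position `s` is `i`, which avoids block `j`, and every other direction lies
    -- in its own block. Hence block `j` meets the subcube in a single coordinate.
    direction-block : ∀ {j} a c → j ≢ s → direction a ≡ dir j c → a ≡ j × c ≡ syndrome j u
    direction-block a c j≢s eq with a ≟ s
    ... | yes _ = contradiction (sym eq) (s-spare _ c j≢s)
    ... | no _ with dir-injective eq
    ...   | refl , refl = refl , refl

    direction-injective : ∀ a b → direction a ≡ direction b → a ≡ b
    direction-injective a b eq with b ≟ s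
    ... | no b≢s = proj₁ (direction-block a _ b≢s eq)
    ... | yes refl with a ≟ s
    ...   | yes a≡s = a≡s
    ...   | no a≢s  = contradiction eq (s-spare a _ a≢s)

    point : Fin (2 ^ m) → Fin (2 ^ n)
    point = corner u direction

    point-injective : ∀ x y → point x ≡ point y → x ≡ y
    point-injective = corner-injective u direction direction-injective

    point-flip : ∀ a x → point (flip a x) ≡ flip (direction a) (point x)
    point-flip = corner-flip u direction direction-injective

    point-flip-s : ∀ x → point (flip s x) ≡ flip i (point x)
    point-flip-s x = trans (point-flip s x) (cong (λ k → flip k (point x)) direction-s)

    point-adj : ∀ a x → DifferInOne n (point x) (point (flip a x))
    point-adj a x = subst (DifferInOne n (point x)) (sym (point-flip a x))
      (flip-adj (direction a) (point x))

    -- Within block `j` the corner differs from `u` exactly at the coordinate labelled by the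
    -- syndrome of `u`, so the syndrome is added to itself and vanishes.
    point-marked : ∀ x → ∃[ j ] (j ≢ s × bit x j ≡ true) → Marked (point x)
    point-marked x (j , j≢s , xⱼ) = j , bit-injective λ k → trans (syndrome-toggle j c at off k)
      (trans (xor-same (bit {r} c k)) (sym (bit-origin {r} k)))
      where
      c = syndrome j u

      at : bit (point x) (dir j c) ≡ not (bit u (dir j c))
      at = subst (λ k → bit (point x) k ≡ not (bit u k)) (direction-≢ j≢s)
        (trans (bit-corner u direction direction-injective x j) (cong (_xor bit u (direction j)) xⱼ))

      off : ∀ c′ → c′ ≢ c → bit (point x) (dir j c′) ≡ bit u (dir j c′)
      off c′ c′≢c = bit-corner-∉ u direction x λ a eq → c′≢c (proj₂ (direction-block a c′ j≢s eq))

    private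
      G⁺ = addEdge u (flip i u) G

    old : ∀ a x → Marked (point x) ⊎ Marked (point (flip a x)) → Edge G⁺ (point x) (point (flip a x))
    old a x mk = edges-⊆ (addEdge-⊒ u (flip i u) G) _ _
      (from (whole-edge markedGraph _ _) (point-adj a x , mk))

    -- With all bits other than `s` equal to 0, the corner is `u` or `flip i u`, so the edge in
    -- direction `s` is the added one, in one of its two orientations.
    new : ∀ x → (∀ j → j ≢ s → bit x j ≡ false) → Edge G⁺ (point x) (point (flip s x))
    new x x≡0 = subst (Edge G⁺ (point x)) (sym (point-flip-s x)) (side (bit x s) refl)
      where
      origin≡u : ∀ y → bit y s ≡ false → (∀ j → j ≢ s → bit y j ≡ false) → point y ≡ u
      origin≡u y yₛ y≡0 = corner-origin u direction direction-injective y zeros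
        where
        zeros : ∀ j → bit y j ≡ false
        zeros j with j ≟ s
        ... | yes refl = yₛ
        ... | no j≢s   = y≡0 j j≢s

      side : ∀ b → bit x s ≡ b → Edge G⁺ (point x) (flip i (point x))
      side false xₛ = subst (λ p → Edge G⁺ p (flip i p)) (sym (origin≡u x xₛ x≡0))
        (addEdge-edge u (flip i u) G)
      side true  xₛ = subst (λ p → Edge G⁺ p (flip i p)) (sym p≡)
        (subst (Edge G⁺ (flip i u)) (sym (flip-involutive i u)) (addEdge-edge˘ u (flip i u) G))
        where
        p≡ : point x ≡ flip i u
        p≡ = trans (sym (flip-involutive i (point x))) (cong (flip i) (trans (sym (point-flip-s x))
          (origin≡u (flip s x) (trans (bit-flip-≡ s x) (cong not xₛ))
            (λ j j≢s → trans (bit-flip-≢ x j≢s) (x≡0 j j≢s)))))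

    point-edge : ∀ x y → DifferInOne m x y → Edge G⁺ (point x) (point y)
    point-edge x y a with adj-flip a
    ... | b , refl with any? (λ j → ¬? (j ≟ s) ×-dec bit x j ≟ᵇ true)
    -- A bit outside `s` marks the first end. Failing that, a step in a direction other than `s`
    -- sets such a bit and marks the second end, while a step in direction `s` is the added edge.
    ...   | yes m₁ = old b x (inj₁ (point-marked x m₁))
    ...   | no ∄₁ with b ≟ s
    ...     | yes refl = new x λ j j≢s → ¬-not λ xⱼ → ∄₁ (j , j≢s , xⱼ)
    ...     | no b≢s   = old b x (inj₂ (point-marked (flip b x) (b , b≢s ,
                trans (bit-flip-≡ b x) (cong not (¬-not λ x_b → ∄₁ (b , b≢s , x_b))))))

    #copies-increase : ¬ Edge G u (flip i u) → #copies (Q m) G <ⁿ #copies (Q m) G⁺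
    #copies-increase ¬e = #copies-< (Q m) (addEdge-⊒ u (flip i u) G) point-injective
      -- The edge absent from `G` is the image of the edge of `Q m` at the origin in direction `s`.
      (λ _ → x∈p∪q⁺ (inj₁ ∈⊤)) point-edge (flip-adj s (origin m))
      λ e → ¬e (subst (λ p → Edge G p (flip i p)) origin≡u (subst (Edge G _) (point-flip-s (origin m)) e))
      where
      origin≡u : point (origin m) ≡ u
      origin≡u = corner-origin u direction direction-injective (origin m) bit-origin

  semiSaturated : Fin m → SemiSaturated (Q n) (Q m) G
  semiSaturated j₀ = record
    { subgraph = G⊆Q
    ; increase = λ u v a → increases u (adj-flip a)
    }
    where
    increases : ∀ u {v} → ∃[ i ] v ≡ flip i u → ¬ Edge G u v →
                #copies (Q m) G <ⁿ #copies (Q m) (addEdge u v G)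
    increases u (i , refl) = let (s , s-spare) = spare j₀ i in Completion.#copies-increase u i s s-spare

  -- The number of edges.

  -- Doubling clears the denominator of m/2. Each block contributes fewer than `P` pairs at its
  -- codewords and one pair for each of the `e` even vertices; writing the former as at most
  -- `ℕ.pred P` keeps the inequality strict after summing over the blocks.
  2*#edges-< : .{{_ : NonZero m}} → Fin n → n <ⁿ m *ⁿ (2 *ⁿ 2 ^ r) →
               2 *ⁿ #edges G <ⁿ (2 *ⁿ m ^ 2 +ⁿ m) *ⁿ 2 ^ n
  2*#edges-< i n< = begin-strict
    2 *ⁿ #edges G                            ≤⟨ ℕ.*-monoʳ-≤ 2 (ℕ.≤-trans
                                                  (#edges-≤ G⊆Q evenEnds ∈-evenEnds) length-evenEnds) ⟩
    2 *ⁿ (m *ⁿ (ℕ.pred P +ⁿ e))              ≡⟨ rearrange₁ m (ℕ.pred P) e ⟩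
    2 *ⁿ (m *ⁿ ℕ.pred P) +ⁿ m *ⁿ (2 *ⁿ e)    <⟨ ℕ.+-mono-<-≤
                                                  (ℕ.*-monoʳ-< 2 (ℕ.*-monoʳ-< m pred<))
                                                  (ℕ.*-monoʳ-≤ m (length-parityClass i false)) ⟩
    2 *ⁿ (m *ⁿ P) +ⁿ m *ⁿ 2 ^ n              ≡⟨ rearrange₂ m (2 ^ n) ⟩
    (2 *ⁿ m ^ 2 +ⁿ m) *ⁿ 2 ^ n               ∎
    where
    open ℕ.≤-Reasoning
    P = m *ⁿ 2 ^ n
    e = length (parityClass n false)
    instance
      P≢0 : NonZero P
      P≢0 = ℕ.m*n≢0 m (2 ^ n) {{it}} {{ℕ.m^n≢0 2 n}}

    pred< : ℕ.pred P <ⁿ P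
    pred< = ℕ.≤-reflexive (ℕ.suc-pred P)

    rearrange₁ : ∀ a p q → 2 *ⁿ (a *ⁿ (p +ⁿ q)) ≡ 2 *ⁿ (a *ⁿ p) +ⁿ a *ⁿ (2 *ⁿ q)
    rearrange₁ = solve-∀

    rearrange₂ : ∀ a q → 2 *ⁿ (a *ⁿ (a *ⁿ q)) +ⁿ a *ⁿ q ≡ (2 *ⁿ (a *ⁿ (a *ⁿ 1)) +ⁿ a) *ⁿ q
    rearrange₂ = solve-∀

    rearrange₃ : ∀ l a q → l *ⁿ (a *ⁿ (2 *ⁿ q)) ≡ a *ⁿ (2 *ⁿ (l *ⁿ q))
    rearrange₃ = solve-∀

    few : ∀ l → l *ⁿ 2 ^ r ≤ length (parityClass n true) → l *ⁿ n <ⁿ P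
    -- Multiplying `n<` by 0 would lose strictness, so this case rests on `P` being positive.
    few zero      _ = ℕ.>-nonZero⁻¹ P
    few l@(suc _) l≤ = begin-strict
      l *ⁿ n                                   <⟨ ℕ.*-monoʳ-< l n< ⟩
      l *ⁿ (m *ⁿ (2 *ⁿ 2 ^ r))                 ≡⟨ rearrange₃ l m (2 ^ r) ⟩
      m *ⁿ (2 *ⁿ (l *ⁿ 2 ^ r))                 ≤⟨ ℕ.*-monoʳ-≤ m (ℕ.*-monoʳ-≤ 2 l≤) ⟩
      m *ⁿ (2 *ⁿ length (parityClass n true))  ≤⟨ ℕ.*-monoʳ-≤ m (length-parityClass i true) ⟩
      P                                        ∎

    length-evenEnds : length evenEnds ≤ m *ⁿ (ℕ.pred P +ⁿ e)
    length-evenEnds = subst (λ k → length evenEnds ≤ k *ⁿ (ℕ.pred P +ⁿ e)) (length-allFin m)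
      (length-concatMap-≤ _ (λ j → ℕ.≤-trans
        (ℕ.≤-reflexive (trans (length-++ (cartesianProduct (codewords j) (allFin n)))
          (cong₂ _+ⁿ_
            (trans (length-cartesianProduct (codewords j) (allFin n))
                   (cong (length (codewords j) *ⁿ_) (length-allFin n)))
            (length-map _ (parityClass n false)))))
        (ℕ.+-monoˡ-≤ e (ℕ.<⇒≤pred (few (length (codewords j)) (length-codewords j)))))
      (allFin m))

-- The whole hypercube, the choice of r, and the two ranges of n.

2*#edges-whole : ∀ {n} → Fin n → 2 *ⁿ #edges (whole (Q n)) ≤ n *ⁿ 2 ^ n
2*#edges-whole {n} i = begin
  2 *ⁿ #edges (whole (Q n))    ≤⟨ ℕ.*-monoʳ-≤ 2 (#edges-≤
                                    (subgraph (whole-semiSaturated (Q n) (Q n))) evenEnds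
                                    λ _ k even _ → ∈-cartesianProduct⁺ (∈-parityClass⁺ n even) (∈-allFin k)) ⟩
  2 *ⁿ length evenEnds         ≡⟨ cong (2 *ⁿ_) (trans
                                    (length-cartesianProduct (parityClass n false) (allFin n))
                                    (cong (e *ⁿ_) (length-allFin n))) ⟩
  2 *ⁿ (e *ⁿ n)                ≡⟨ rearrange e n ⟩
  n *ⁿ (2 *ⁿ e)                ≤⟨ ℕ.*-monoʳ-≤ n (length-parityClass i false) ⟩
  n *ⁿ 2 ^ n                   ∎
  where
  open ℕ.≤-Reasoning
  evenEnds = cartesianProduct (parityClass n false) (allFin n)
  e = length (parityClass n false)

  rearrange : ∀ a b → 2 *ⁿ (a *ⁿ b) ≡ b *ⁿ (2 *ⁿ a)
  rearrange = solve-∀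

n<2^n : ∀ n → n <ⁿ 2 ^ n
n<2^n zero    = s≤s z≤n
n<2^n (suc n) = subst (suc (suc n) ≤_) (cong (2 ^ n +ⁿ_) (sym (ℕ.+-identityʳ _)))
  (ℕ.+-mono-≤ (ℕ.m^n>0 2 n) (n<2^n n))

-- The exponent is lowered from n, where the upper bound holds because n is less than 2ⁿ. Each
-- failure of the lower bound is the upper bound for the next smaller exponent, and at exponent 0
-- the lower bound is `m≤n`.
dyadicScale : ∀ {m n} .{{_ : NonZero m}} → m ≤ n →
              ∃[ r ] (m *ⁿ 2 ^ r ≤ n × n <ⁿ m *ⁿ (2 *ⁿ 2 ^ r))
dyadicScale {m} {n} m≤n =
  search n (ℕ.<-≤-trans (n<2^n n) (ℕ.≤-trans (ℕ.m≤m+n _ _) (ℕ.m≤n*m (2 *ⁿ 2 ^ n) m)))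
  where
  search : ∀ k → n <ⁿ m *ⁿ (2 *ⁿ 2 ^ k) → ∃[ r ] (m *ⁿ 2 ^ r ≤ n × n <ⁿ m *ⁿ (2 *ⁿ 2 ^ r))
  search k n< with m *ⁿ 2 ^ k ℕ.≤? n
  ... | yes ≤n = k , ≤n , n<
  search zero    n< | no ≰n = contradiction (subst (_≤ n) (sym (ℕ.*-identityʳ m)) m≤n) ≰n
  search (suc k) n< | no ≰n = search k (ℕ.≰⇒> ≰n)

2*s-sat-<-blocks : ∀ n m .{{_ : NonZero n}} .{{_ : NonZero m}} → m ≤ n →
                   2 *ⁿ s-sat (Q n) (Q m) <ⁿ (2 *ⁿ m ^ 2 +ⁿ m) *ⁿ 2 ^ n
2*s-sat-<-blocks n m m≤n =
  let (r , m2ʳ≤n , n<) = dyadicScale m≤n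
      -- The blocks are consecutive intervals of length 2ʳ among the first m 2ʳ coordinates.
      open Blocks {n} {m} {r} (λ j c → inject≤ (combine j c) m2ʳ≤n)
             (λ eq → combine-injective _ _ _ _ (inject≤-injective m2ʳ≤n m2ʳ≤n _ _ eq))
  in ℕ.≤-<-trans
       (ℕ.*-monoʳ-≤ 2 (s-sat-minimal (Q n) (Q m) (semiSaturated (Fin.fromℕ< (ℕ.>-nonZero⁻¹ m)))))
       (2*#edges-< (Fin.fromℕ< (ℕ.>-nonZero⁻¹ n)) n<)

2*s-sat-<-whole : ∀ n m .{{_ : NonZero n}} → n <ⁿ m →
                  2 *ⁿ s-sat (Q n) (Q m) <ⁿ (2 *ⁿ m ^ 2 +ⁿ m) *ⁿ 2 ^ n
2*s-sat-<-whole n m n<m = ℕ.≤-<-trans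
  (ℕ.≤-trans (ℕ.*-monoʳ-≤ 2 (s-sat-minimal (Q n) (Q m) (whole-semiSaturated (Q n) (Q m))))
             (2*#edges-whole (Fin.fromℕ< (ℕ.>-nonZero⁻¹ n))))
  -- The summand m of the coefficient 2m² + m alone exceeds n.
  (ℕ.*-monoˡ-< (2 ^ n) {{ℕ.m^n≢0 2 n}} (ℕ.<-≤-trans n<m (ℕ.m≤n+m m (2 *ⁿ m ^ 2))))

2*s-sat-< : ∀ n m .{{_ : NonZero n}} .{{_ : NonZero m}} →
            2 *ⁿ s-sat (Q n) (Q m) <ⁿ (2 *ⁿ m ^ 2 +ⁿ m) *ⁿ 2 ^ n
2*s-sat-< n m = [ 2*s-sat-<-blocks n m , 2*s-sat-<-whole n m ]′ (ℕ.≤-<-connex m n)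

-- Passage to the rational inequality.

toℚᵘ-/ : ∀ a b .{{_ : NonZero b}} → toℚᵘ (+ a / b) ≃ (+ a ℚᵘ./ b)
toℚᵘ-/ a b@(suc _) = toℚᵘ-fromℚᵘ (+ a ℚᵘ./ b)

-- Unnormalised fractions keep the denominators 1 and 2, so cross-multiplying them gives the doubled
-- inequality between natural numbers.
<-ℕ→ℚ : ∀ s k l p → 2 *ⁿ s <ⁿ (2 *ⁿ k +ⁿ l) *ⁿ p →
        ℕ→ℚ s < (ℕ→ℚ k + (+ l / 2)) * ℕ→ℚ p
<-ℕ→ℚ s k l p lt = toℚᵘ-cancel-<
  (ℚᵘ.<-respʳ-≃ (ℚᵘ.≃-sym rhs) (ℚᵘ.<-respˡ-≃ (ℚᵘ.≃-sym (toℚᵘ-/ s 1)) cross))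
  where
  rhs : toℚᵘ ((ℕ→ℚ k + (+ l / 2)) * ℕ→ℚ p) ≃ (+ k ℚᵘ./ 1 ℚᵘ.+ + l ℚᵘ./ 2) ℚᵘ.* (+ p ℚᵘ./ 1)
  rhs = ℚᵘ.≃-trans (toℚᵘ-homo-* (ℕ→ℚ k + (+ l / 2)) (ℕ→ℚ p))
    (ℚᵘ.*-cong
      (ℚᵘ.≃-trans (toℚᵘ-homo-+ (ℕ→ℚ k) (+ l / 2)) (ℚᵘ.+-cong (toℚᵘ-/ k 1) (toℚᵘ-/ l 2)))
      (toℚᵘ-/ p 1))

  cross : + s ℚᵘ./ 1 ℚᵘ.< (+ k ℚᵘ./ 1 ℚᵘ.+ + l ℚᵘ./ 2) ℚᵘ.* (+ p ℚᵘ./ 1)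
  cross = ℚᵘ.*<* (subst₂ ℤ._<_ (sym left) (sym right) (+<+ lt))
    where
    left : + s ℤ.* + 2 ≡ + (2 *ⁿ s)
    left = trans (sym (ℤ.pos-* s 2)) (cong +_ (ℕ.*-comm s 2))

    right : (+ k ℤ.* + 2 ℤ.+ + l ℤ.* + 1) ℤ.* + p ℤ.* + 1 ≡ + ((2 *ⁿ k +ⁿ l) *ⁿ p)
    right = trans (ℤ.*-identityʳ _) (trans (cong (ℤ._* + p) (cong₂ ℤ._+_
      (trans (sym (ℤ.pos-* k 2)) (cong +_ (ℕ.*-comm k 2))) (ℤ.*-identityʳ (+ l))))
      (sym (ℤ.pos-* (2 *ⁿ k +ⁿ l) p)))

theorem2 : ∀ (n m : ℕ) .{{_ : NonZero n}} .{{_ : NonZero m}} →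
    ℕ→ℚ (s-sat (Q n) (Q m)) < (ℕ→ℚ (m ^ 2) + (+ m / 2)) * ℕ→ℚ (2 ^ n)
theorem2 n m = <-ℕ→ℚ (s-sat (Q n) (Q m)) (m ^ 2) m (2 ^ n) (2*s-sat-< n m)
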